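{- Let $\mathscr{R}$ be a set of sound inference rules satisfying the following property: (*) for any rule in $\mathscr{R}$ that has more than one conclusion formula, any truth assignment that falsifies one of its conclusion formulas satisfies all its other conclusion formulas. Let $\mathscr{H}$ be a set of formulas (the hypotheses) and let $A$ be a formula (the goal). If there is a circular proof of $A$ from $\mathscr{H}$ through the rules in $\mathscr{R}$, then every truth assignment that satisfies every formula in $\mathscr{H}$ also satisfies $A$.
   Context: Formulas. A literal is a propositional variable $X$ or its negation $\overline{X}$. Formulas are in negation normal form: built from literals by disjunction and conjunction. Both $\vee$ and $\wedge$ are treated as associative, commutative and idempotent (i.e. as operations on finite sets of formulas); the empty disjunction $0$ is always false and the empty conjunction $1$ is always true. Truth assignments evaluate formulas as usual. Inference rules. An inference rule is given by a finite sequence of premise formulas $A_1,\dots,A_r$ and a finite sequence of conclusion formulas $B_1,\dots,B_s$; it is sound if every truth assignment satisfying all premises satisfies all conclusions. An instance of a rule is obtained by applying one substitution (of formulas for variables, a negated variable being replaced by the dual, i.e. De Morgan negation, of the substituted formula) to all its premises and conclusions. Circular proofs. A circular pre-proof $\Pi$ over a set of inference rules is a finite directed bipartite graph $G(\Pi)$ with two types of vertices, formula-vertices (set $J$) and inference-vertices (set $I$), every edge going between the two types. Each formula-vertex is labelled by a formula (different vertices may carry the same formula). Each inference-vertex is labelled by an instance of a rule whose premises are the formulas labelling its in-neighbours and whose conclusions are the formulas labelling its out-neighbours (one in-neighbour per premise, one out-neighbour per conclusion). Cycles are allowed. $N^-(u)$ and $N^+(u)$ denote the sets of in- and out-neighbours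 of $u$. A flow assignment is a map $F:I\to\mathbb{R}^+$ to the positive reals. The balance of $u\in J$ is $B(u)=\sum_{w\in N^-(u)}F(w)-\sum_{w\in N^+(u)}F(w)$. Formula-vertices with $B(u)<0$ are sources of $G(\Pi,F)$ and those with $B(u)>0$ are sinks. $F$ witnesses a proof of $A$ from $\mathscr{H}$ if every source is labelled by a formula in $\mathscr{H}$ and some sink is labelled by $A$. A circular proof of $A$ from $\mathscr{H}$ is a circular pre-proof for which there exists a flow assignment witnessing a proof of $A$ from $\mathscr{H}$. -}

module Defs where

open import Data.Bool.Base using (Bool; true; false; not; T; _∧_; _∨_)
open import Data.Fin.Base using (Fin)
open import Data.List.Base using (List; map; foldr; filterᵇ; allFin; length; lookup)
open import Data.Nat.Base as ℕ using (ℕ)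
import Data.Nat.Properties as ℕ
open import Data.Product.Base using (∃; ∃-syntax; _×_; _,_; proj₁)
open import Data.Rational.Base as ℚ using (ℚ; 0ℚ; ½; ∣_∣)
import Data.Rational.Properties as ℚ
open import Data.Rational.Solver using (module +-*-Solver)
open import Function.Bundles using (_↔_; module Inverse)
open import Level using (0ℓ)
open import Relation.Binary.PropositionalEquality
  using (_≡_; _≢_; refl; sym; trans; cong; subst)
open import Relation.Unary using (Pred; _∈_)

------------------------------------------------------------------------
-- Real numbers: Cauchy sequences of rationals.
-- Real equality would be the relation "the difference tends to 0"; it is
-- not needed below, since flows enter only through sums and strict order,
-- both of which respect it.

record ℝ : Set where
  field
    seq    : ℕ → ℚ
    cauchy : ∀ ε → 0ℚ ℚ.< ε →
             ∃[ N ] (∀ m n → N ℕ.≤ m → N ℕ.≤ n → ∣ seq m ℚ.- seq n ∣ ℚ.< ε)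

open ℝ public

private
  half-pos : ∀ ε → 0ℚ ℚ.< ε → 0ℚ ℚ.< ½ ℚ.* ε
  half-pos ε 0<ε = subst (ℚ._< ½ ℚ.* ε) (ℚ.*-zeroʳ ½) (ℚ.*-monoʳ-<-pos ½ 0<ε)

  halves : ∀ ε → ½ ℚ.* ε ℚ.+ ½ ℚ.* ε ≡ ε
  halves ε = trans (sym (ℚ.*-distribʳ-+ ε ½ ½)) (ℚ.*-identityˡ ε)

  +-interchange : ∀ a b c d →
                  (a ℚ.+ b) ℚ.- (c ℚ.+ d) ≡ (a ℚ.- c) ℚ.+ (b ℚ.- d)
  +-interchange = solve 4 (λ a b c d →
    (a :+ b) :- (c :+ d) := (a :- c) :+ (b :- d)) refl
    where open +-*-Solver

  neg-interchange : ∀ a b → (ℚ.- a) ℚ.- (ℚ.- b) ≡ ℚ.- (a ℚ.- b)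
  neg-interchange = solve 2 (λ a b → (:- a) :- (:- b) := :- (a :- b)) refl
    where open +-*-Solver

0ℝ : ℝ
0ℝ .seq _ = 0ℚ
0ℝ .cauchy ε 0<ε = 0 , λ _ _ _ _ → 0<ε

infixl 6 _+ℝ_ _-ℝ_
infix  8 -ℝ_
infix  4 _<ℝ_

_+ℝ_ : ℝ → ℝ → ℝ
(x +ℝ y) .seq n = seq x n ℚ.+ seq y n
(x +ℝ y) .cauchy ε 0<ε
  with cauchy x (½ ℚ.* ε) (half-pos ε 0<ε) | cauchy y (½ ℚ.* ε) (half-pos ε 0<ε)
... | M , p | N , q = M ℕ.⊔ N , λ m n m≥ n≥ → begin-strict
  ∣ (seq x m ℚ.+ seq y m) ℚ.- (seq x n ℚ.+ seq y n) ∣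
    ≡⟨ cong ∣_∣ (+-interchange (seq x m) (seq y m) (seq x n) (seq y n)) ⟩
  ∣ (seq x m ℚ.- seq x n) ℚ.+ (seq y m ℚ.- seq y n) ∣
    ≤⟨ ℚ.∣p+q∣≤∣p∣+∣q∣ (seq x m ℚ.- seq x n) (seq y m ℚ.- seq y n) ⟩
  ∣ seq x m ℚ.- seq x n ∣ ℚ.+ ∣ seq y m ℚ.- seq y n ∣
    <⟨ ℚ.+-mono-< (p m n (ℕ.m⊔n≤o⇒m≤o M N m≥) (ℕ.m⊔n≤o⇒m≤o M N n≥))
                  (q m n (ℕ.m⊔n≤o⇒n≤o M N m≥) (ℕ.m⊔n≤o⇒n≤o M N n≥)) ⟩
  ½ ℚ.* ε ℚ.+ ½ ℚ.* ε
    ≡⟨ halves ε ⟩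
  ε ∎
  where open ℚ.≤-Reasoning

-ℝ_ : ℝ → ℝ
(-ℝ x) .seq n = ℚ.- seq x n
(-ℝ x) .cauchy ε 0<ε with cauchy x ε 0<ε
... | N , p = N , λ m n m≥ n≥ →
  subst (ℚ._< ε)
    (sym (trans (cong ∣_∣ (neg-interchange (seq x m) (seq x n)))
                (ℚ.∣-p∣≡∣p∣ (seq x m ℚ.- seq x n))))
    (p m n m≥ n≥)

_-ℝ_ : ℝ → ℝ → ℝ
x -ℝ y = x +ℝ (-ℝ y)

-- Eventually separated by a fixed positive rational, not merely
-- termwise smaller.
_<ℝ_ : ℝ → ℝ → Set
x <ℝ y = ∃[ ε ] (0ℚ ℚ.< ε × ∃[ N ] (∀ n → N ℕ.≤ n → seq x n ℚ.+ ε ℚ.< seq y n))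

sumℝ : List ℝ → ℝ
sumℝ = foldr _+ℝ_ 0ℝ

------------------------------------------------------------------------
-- Formulas in negation normal form over a set V of variables

infixr 6 _⋀_
infixr 5 _⋁_

data Formula (V : Set) : Set where
  pos neg : V → Formula V
  ⊥′ ⊤′   : Formula V
  _⋁_ _⋀_ : Formula V → Formula V → Formula V

infix 4 _≈_

-- Identity of formulas when ⋁ and ⋀ are operations on finite sets, with
-- ⊥′ and ⊤′ the disjunction and conjunction of the empty set.
data _≈_ {V : Set} : Formula V → Formula V → Set where
  ≈-refl  : ∀ {A} → A ≈ A
  ≈-sym   : ∀ {A B} → A ≈ B → B ≈ A
  ≈-trans : ∀ {A B C} → A ≈ B → B ≈ C → A ≈ C
  ⋁-cong  : ∀ {A A′ B B′} → A ≈ A′ → B ≈ B′ → A ⋁ B ≈ A′ ⋁ B′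
  ⋁-assoc : ∀ {A B C} → (A ⋁ B) ⋁ C ≈ A ⋁ (B ⋁ C)
  ⋁-comm  : ∀ {A B} → A ⋁ B ≈ B ⋁ A
  ⋁-idem  : ∀ {A} → A ⋁ A ≈ A
  ⋁-unit  : ∀ {A} → ⊥′ ⋁ A ≈ A
  ⋀-cong  : ∀ {A A′ B B′} → A ≈ A′ → B ≈ B′ → A ⋀ B ≈ A′ ⋀ B′
  ⋀-assoc : ∀ {A B C} → (A ⋀ B) ⋀ C ≈ A ⋀ (B ⋀ C)
  ⋀-comm  : ∀ {A B} → A ⋀ B ≈ B ⋀ A
  ⋀-idem  : ∀ {A} → A ⋀ A ≈ A
  ⋀-unit  : ∀ {A} → ⊤′ ⋀ A ≈ A

infix 4 _∈≈_

_∈≈_ : {V : Set} → Formula V → Pred (Formula V) 0ℓ → Set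
A ∈≈ 𝓗 = ∃[ B ] (B ∈ 𝓗 × A ≈ B)

Assignment : Set → Set
Assignment V = V → Bool

eval : {V : Set} → Assignment V → Formula V → Bool
eval α (pos X) = α X
eval α (neg X) = not (α X)
eval α ⊥′      = false
eval α ⊤′      = true
eval α (A ⋁ B) = eval α A ∨ eval α B
eval α (A ⋀ B) = eval α A ∧ eval α B

infix 4 _⊨_ _⊭_

_⊨_ _⊭_ : {V : Set} → Assignment V → Formula V → Set
α ⊨ A = eval α A ≡ true
α ⊭ A = eval α A ≡ false

dual : {V : Set} → Formula V → Formula V
dual (pos X) = neg X
dual (neg X) = pos X
dual ⊥′      = ⊤′
dual ⊤′      = ⊥′
dual (A ⋁ B) = dual A ⋀ dual B
dual (A ⋀ B) = dual A ⋁ dual B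

Substitution : Set → Set
Substitution V = V → Formula V

infixl 8 _[_]

_[_] : {V : Set} → Formula V → Substitution V → Formula V
pos X   [ σ ] = σ X
neg X   [ σ ] = dual (σ X)
⊥′      [ σ ] = ⊥′
⊤′      [ σ ] = ⊤′
(A ⋁ B) [ σ ] = A [ σ ] ⋁ B [ σ ]
(A ⋀ B) [ σ ] = A [ σ ] ⋀ B [ σ ]

------------------------------------------------------------------------
-- Inference rules

record Rule (V : Set) : Set where
  field
    premises    : List (Formula V)
    conclusions : List (Formula V)

open Rule public

Sound : {V : Set} → Rule V → Set
Sound {V} R = (α : Assignment V) →
  (∀ i → α ⊨ lookup (premises R) i) → (∀ j → α ⊨ lookup (conclusions R) j)

-- "Other" conclusions are other positions of the sequence: a formula
-- occurring twice counts as two conclusions.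
FalsifiedSatisfiesOthers : {V : Set} → Rule V → Set
FalsifiedSatisfiesOthers {V} R = 1 ℕ.< length (conclusions R) →
  (α : Assignment V) (i : Fin (length (conclusions R))) →
  α ⊭ lookup (conclusions R) i →
  ∀ j → j ≢ i → α ⊨ lookup (conclusions R) j

------------------------------------------------------------------------
-- Circular proofs

record PreProof {V : Set} (𝓡 : Pred (Rule V) 0ℓ) : Set where
  field
    ∣J∣ ∣I∣ : ℕ

  J : Set
  J = Fin ∣J∣

  I : Set
  I = Fin ∣I∣

  field
    edgeJI : J → I → Bool
    edgeIJ : I → J → Bool
    label  : J → Formula V
    rule   : I → Rule V
    rule∈𝓡 : ∀ w → rule w ∈ 𝓡
    σ      : I → Substitution V
    ins    : ∀ w → Fin (length (premises (rule w)))    ↔ (∃[ u ] T (edgeJI u w))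
    outs   : ∀ w → Fin (length (conclusions (rule w))) ↔ (∃[ u ] T (edgeIJ w u))
    ins-label  : ∀ w i →
      label (proj₁ (Inverse.to (ins w) i)) ≈ lookup (premises (rule w)) i [ σ w ]
    outs-label : ∀ w j →
      label (proj₁ (Inverse.to (outs w) j)) ≈ lookup (conclusions (rule w)) j [ σ w ]

  N⁻ N⁺ : J → List I
  N⁻ u = filterᵇ (λ w → edgeIJ w u) (allFin ∣I∣)
  N⁺ u = filterᵇ (λ w → edgeJI u w) (allFin ∣I∣)

module _ {V : Set} {𝓡 : Pred (Rule V) 0ℓ} (Π : PreProof 𝓡) where
  open PreProof Π

  record Flow : Set where
    field
      F        : I → ℝ
      positive : ∀ w → 0ℝ <ℝ F w

  balance : Flow → J → ℝ
  balance 𝓕 u = sumℝ (map F (N⁻ u)) -ℝ sumℝ (map F (N⁺ u))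
    where open Flow 𝓕

  IsSource IsSink : Flow → J → Set
  IsSource 𝓕 u = balance 𝓕 u <ℝ 0ℝ
  IsSink   𝓕 u = 0ℝ <ℝ balance 𝓕 u

  Witnesses : Flow → Pred (Formula V) 0ℓ → Formula V → Set
  Witnesses 𝓕 𝓗 A =
    (∀ u → IsSource 𝓕 u → label u ∈≈ 𝓗) ×
    (∃[ u ] (IsSink 𝓕 u × label u ≈ A))

record CircularProof {V : Set} (𝓡 : Pred (Rule V) 0ℓ)
                     (𝓗 : Pred (Formula V) 0ℓ) (A : Formula V) : Set where
  field
    preProof  : PreProof 𝓡
    flow      : Flow preProof
    witnesses : Witnesses preProof flow 𝓗 A

{-# OPTIONS --safe #-}

-- Suppose α satisfies the hypotheses but falsifies A, and sum the balances
-- of the formula-vertices falsified by α.  No source is falsified, so no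
-- term is negative, while the sink labelled A contributes a positive one.
-- Summed instead over inferences, w contributes F(w) times (its falsified
-- conclusions minus its falsified premises), which is never positive: by
-- (*) w has at most one falsified conclusion, and by soundness a falsified
-- premise whenever it has one.
module Submission where

open import Data.Bool.Base using (Bool; true; false; not; T; _∧_; _∨_; if_then_else_)
open import Data.Bool.Properties
  using (T?; T-∧; T-not-≡; ¬-not; not-involutive; ∨-∧-booleanAlgebra;
         ∨-assoc; ∨-comm; ∨-idem; ∧-assoc; ∧-comm; ∧-idem)
open import Data.Fin.Base using (Fin; zero; suc)
open import Data.Fin.Properties using (any?; suc-injective) renaming (_≟_ to _≟ᶠ_)
open import Data.List.Base as List using (filterᵇ; tabulate; lookup)
open import Data.Nat.Base as ℕ using (ℕ; zero; suc; z≤n; s≤s)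
import Data.Nat.Properties as ℕ
open import Data.Product.Base using (∃-syntax; _×_; _,_; proj₁)
open import Data.Rational.Base using (ℚ; 0ℚ; ½; ∣_∣; _+_; _-_; -_; _*_; _≤_; _<_)
open import Data.Rational.Properties
open import Data.Rational.Solver using (module +-*-Solver)
open import Data.Vec.Functional using (Vector)
open import Defs
open import Function.Base using (_∘_; id)
open import Function.Bundles using (module Inverse; module Equivalence)
open import Level using (0ℓ)
open import Relation.Binary.PropositionalEquality
  using (_≡_; _≢_; refl; sym; trans; cong; cong₂; subst)
open import Relation.Nullary using (¬_; yes; no; contradiction)
open import Relation.Unary using (Pred; _∈_)

open +-*-Solver using (solve; _:+_; _:-_; :-_; _:=_)
open import Algebra.Lattice.Properties.BooleanAlgebra ∨-∧-booleanAlgebra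
  using (deMorgan₁; deMorgan₂)
open import Algebra.Properties.CommutativeMonoid.Sum +-0-commutativeMonoid
  using (sum; ∑-distrib-+; ∑-comm; sum-cong-≗; sum-replicate-zero)

-- Rational sequences and their eventual bounds.

half : ∀ ε → 0ℚ < ε → ∃[ δ ] (0ℚ < δ × δ + δ ≡ ε)
half ε 0<ε = ½ * ε
  , subst (_< ½ * ε) (*-zeroʳ ½) (*-monoʳ-<-pos ½ 0<ε)
  , trans (sym (*-distribʳ-+ ε ½ ½)) (*-identityˡ ε)

p≤∣p∣ : ∀ p → p ≤ ∣ p ∣
p≤∣p∣ p with 0ℚ ≤? p
... | yes 0≤p = ≤-reflexive (sym (0≤p⇒∣p∣≡p 0≤p))
... | no  0≰p = ≤-trans (<⇒≤ (≰⇒> 0≰p)) (0≤∣p∣ p)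

Eventually : Pred ℕ 0ℓ → Set
Eventually P = ∃[ N ] (∀ n → N ℕ.≤ n → P n)

eventually-zip : {P Q R : Pred ℕ 0ℓ} → (∀ n → P n → Q n → R n) →
                 Eventually P → Eventually Q → Eventually R
eventually-zip f (M , p) (N , q) =
  M ℕ.⊔ N , λ n n≥ → f n (p n (ℕ.m⊔n≤o⇒m≤o M N n≥)) (q n (ℕ.m⊔n≤o⇒n≤o M N n≥))

eventually-∀ : ∀ {k} {P : Fin k → Pred ℕ 0ℓ} →
               (∀ i → Eventually (P i)) → Eventually (λ n → ∀ i → P i n)
eventually-∀ {zero}  h = 0 , λ _ _ ()
eventually-∀ {suc k} h =
  eventually-zip (λ { n p ps zero → p ; n p ps (suc i) → ps i })
    (h zero) (eventually-∀ (h ∘ suc))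

-- Equivalent, for Cauchy sequences, to the real not being negative; unlike
-- that negation it adds up directly.
AlmostNonNeg : (ℕ → ℚ) → Set
AlmostNonNeg x = ∀ δ → 0ℚ < δ → Eventually (λ n → - δ < x n)

-- The relation `0ℝ <ℝ x` on bare sequences, so that termwise sums need no Cauchy proof.
BoundedBelow₀ : (ℕ → ℚ) → Set
BoundedBelow₀ x = ∃[ ε ] (0ℚ < ε × Eventually (λ n → ε < x n))

-- With `δ` split as `η + η`, a single late term at or below `- δ` would, by the Cauchy condition,
-- hold all late terms below `- η`, and `η` would then witness `x <ℝ 0ℝ`. The order on ℚ is
-- decidable, so refuting such a term is enough.
≮0⇒almostNonNeg : ∀ x → ¬ (x <ℝ 0ℝ) → AlmostNonNeg (seq x)
≮0⇒almostNonNeg x x≮0 δ 0<δ with half δ 0<δ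
... | η , 0<η , refl with cauchy x η 0<η
... | N , close = N , λ n n≥N → ≰⇒> λ xₙ≤ → x≮0 (η , 0<η , N , λ m m≥N → begin-strict
  seq x m + η
    ≡⟨ solve 3 (λ a b e → a :+ e := (a :- b) :+ (b :+ e)) refl (seq x m) (seq x n) η ⟩
  (seq x m - seq x n) + (seq x n + η)
    ≤⟨ +-monoˡ-≤ (seq x n + η) (p≤∣p∣ (seq x m - seq x n)) ⟩
  ∣ seq x m - seq x n ∣ + (seq x n + η)
    <⟨ +-mono-<-≤ (close m n m≥N n≥N) (+-monoˡ-≤ η xₙ≤) ⟩
  η + (- (η + η) + η)
    ≡⟨ solve 1 (λ e → e :+ ((:- (e :+ e)) :+ e) := e :- e) refl η ⟩
  η - η
    ≡⟨ +-inverseʳ η ⟩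
  0ℚ ∎)
  where open ≤-Reasoning

almostNonNeg-0 : AlmostNonNeg (λ _ → 0ℚ)
almostNonNeg-0 δ 0<δ = 0 , λ _ _ → neg-antimono-< 0<δ

almostNonNeg-+ : ∀ {x y} → AlmostNonNeg x → AlmostNonNeg y →
                 AlmostNonNeg (λ n → x n + y n)
almostNonNeg-+ x≥0 y≥0 δ 0<δ with half δ 0<δ
... | η , 0<η , refl =
  eventually-zip (λ n p q → subst (_< _) (sym (neg-distrib-+ η η)) (+-mono-< p q))
    (x≥0 η 0<η) (y≥0 η 0<η)

-- Half of the lower bound on `x` absorbs the slack of `y`; the other half remains.
boundedBelow₀-+ : ∀ {x y} → BoundedBelow₀ x → AlmostNonNeg y →
                  BoundedBelow₀ (λ n → x n + y n)
boundedBelow₀-+ (ε , 0<ε , x>ε) y≥0 with half ε 0<ε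
... | η , 0<η , refl = η , 0<η ,
  eventually-zip
    (λ n p q → subst (_< _) (solve 1 (λ e → (e :+ e) :- e := e) refl η) (+-mono-< p q))
    x>ε (y≥0 η 0<η)

boundedBelow₀-cong : ∀ {x y} → (∀ n → x n ≡ y n) → BoundedBelow₀ x → BoundedBelow₀ y
boundedBelow₀-cong eq (ε , 0<ε , N , h) =
  ε , 0<ε , N , λ n n≥N → subst (ε <_) (eq n) (h n n≥N)

almostNonNeg-sum : ∀ {k} {x : Fin k → ℕ → ℚ} → (∀ i → AlmostNonNeg (x i)) →
                   AlmostNonNeg (λ n → sum (λ i → x i n))
almostNonNeg-sum {zero}  h = almostNonNeg-0
almostNonNeg-sum {suc k} h = almostNonNeg-+ (h zero) (almostNonNeg-sum (h ∘ suc))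

boundedBelow₀-sum : ∀ {k} {x : Fin k → ℕ → ℚ} → (∀ i → AlmostNonNeg (x i)) →
                    ∀ i → BoundedBelow₀ (x i) → BoundedBelow₀ (λ n → sum (λ i → x i n))
boundedBelow₀-sum h zero    p = boundedBelow₀-+ p (almostNonNeg-sum (h ∘ suc))
boundedBelow₀-sum {x = x} h (suc i) p =
  boundedBelow₀-cong (λ n → +-comm _ (x zero n))
    (boundedBelow₀-+ (boundedBelow₀-sum (h ∘ suc) i p) (h zero))

-- Finite sums restricted by Boolean tests.

sum-mono-≤ : ∀ {k} {f g : Vector ℚ k} → (∀ i → f i ≤ g i) → sum f ≤ sum g
sum-mono-≤ {zero}  h = ≤-refl
sum-mono-≤ {suc k} h = +-mono-≤ (h zero) (sum-mono-≤ (h ∘ suc))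

-- Deselected terms become zero instead of being dropped, so every sum runs over a fixed index range
-- and double sums can be exchanged.
when : Bool → ℚ → ℚ
when b q = if b then q else 0ℚ

when-nonNeg : ∀ b {q} → 0ℚ ≤ q → 0ℚ ≤ when b q
when-nonNeg true  0≤q = 0≤q
when-nonNeg false _   = ≤-refl

when-true : ∀ {b} q → T b → when b q ≡ q
when-true {true} q _ = refl

when-false : ∀ {b} q → ¬ T b → when b q ≡ 0ℚ
when-false {true}  q ¬b = contradiction _ ¬b
when-false {false} q _  = refl

sum-when-none : ∀ {k} (f : Vector Bool k) {q} → (∀ i → ¬ T (f i)) →
                sum (λ i → when (f i) q) ≡ 0ℚ
sum-when-none {k} f {q} none =
  trans (sum-cong-≗ (λ i → when-false q (none i))) (sum-replicate-zero k)

sum-when-nonNeg : ∀ {k} (f : Vector Bool k) {q} → 0ℚ ≤ q → 0ℚ ≤ sum (λ i → when (f i) q)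
sum-when-nonNeg {zero}  f 0≤q = ≤-refl
sum-when-nonNeg {suc k} f 0≤q =
  +-mono-≤ (when-nonNeg (f zero) 0≤q) (sum-when-nonNeg (f ∘ suc) 0≤q)

sum-when-≥ : ∀ {k} (f : Vector Bool k) {q} → 0ℚ ≤ q → ∃[ i ] T (f i) →
             q ≤ sum (λ i → when (f i) q)
sum-when-≥ f {q} 0≤q (zero , f₀) = begin
  q
    ≡⟨ +-identityʳ q ⟨
  q + 0ℚ
    ≤⟨ +-mono-≤ (≤-reflexive (sym (when-true q f₀))) (sum-when-nonNeg (f ∘ suc) 0≤q) ⟩
  when (f zero) q + sum (λ i → when (f (suc i)) q) ∎
  where open ≤-Reasoning
sum-when-≥ f {q} 0≤q (suc i , fi) = begin
  q
    ≡⟨ +-identityˡ q ⟨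
  0ℚ + q
    ≤⟨ +-mono-≤ (when-nonNeg (f zero) 0≤q) (sum-when-≥ (f ∘ suc) 0≤q (i , fi)) ⟩
  when (f zero) q + sum (λ i → when (f (suc i)) q) ∎
  where open ≤-Reasoning

sum-when-≤ : ∀ {k} (f : Vector Bool k) {q} → 0ℚ ≤ q →
             (∀ i j → T (f i) → T (f j) → i ≡ j) → sum (λ i → when (f i) q) ≤ q
sum-when-≤ {zero}  f 0≤q unique = 0≤q
sum-when-≤ {suc k} f {q} 0≤q unique with T? (f zero)
... | no ¬f₀ = begin
  when (f zero) q + sum (λ i → when (f (suc i)) q)
    ≤⟨ +-mono-≤ (≤-reflexive (when-false q ¬f₀))
         (sum-when-≤ (f ∘ suc) 0≤q λ i j fi fj → suc-injective (unique _ _ fi fj)) ⟩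
  0ℚ + q
    ≡⟨ +-identityˡ q ⟩
  q ∎
  where open ≤-Reasoning
... | yes f₀ = begin
  when (f zero) q + sum (λ i → when (f (suc i)) q)
    ≡⟨ cong₂ _+_ (when-true q f₀)
         (sum-when-none (f ∘ suc) λ i fi → contradiction (unique zero (suc i) f₀ fi) λ ()) ⟩
  q + 0ℚ
    ≡⟨ +-identityʳ q ⟩
  q ∎
  where open ≤-Reasoning

-- Each side is a number of copies of `q`: at most one on the left, and at least one on the right as
-- soon as the left has one.
sum-when-mono : ∀ {k l} (f : Vector Bool k) (g : Vector Bool l) {q} → 0ℚ ≤ q →
                (∀ i j → T (f i) → T (f j) → i ≡ j) →
                (∃[ i ] T (f i) → ∃[ j ] T (g j)) →
                sum (λ i → when (f i) q) ≤ sum (λ j → when (g j) q)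
sum-when-mono f g 0≤q unique transfer with any? (T? ∘ f)
... | yes some = ≤-trans (sum-when-≤ f 0≤q unique) (sum-when-≥ g 0≤q (transfer some))
... | no none  = subst (_≤ _) (sym (sum-when-none f λ i fi → none (i , fi)))
                   (sum-when-nonNeg g 0≤q)

-- Links the list sums in `balance` to `sum`. Only `g = id` is wanted, but the induction passes from
-- `g` to `g ∘ suc`.
seq-sumℝ-filter : ∀ {I : Set} (F : I → ℝ) (p : I → Bool) n {k} (g : Vector I k) →
  seq (sumℝ (List.map F (filterᵇ p (tabulate g)))) n ≡ sum (λ i → when (p (g i)) (seq (F (g i)) n))
seq-sumℝ-filter F p n {zero}  g = refl
seq-sumℝ-filter F p n {suc k} g with p (g zero)
... | true  = cong (seq (F (g zero)) n +_) (seq-sumℝ-filter F p n (g ∘ suc))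
... | false = trans (seq-sumℝ-filter F p n (g ∘ suc)) (sym (+-identityˡ _))

-- Evaluation under identity of formulas, duals and substitution.

module _ {V : Set} where

  eval-cong : ∀ (α : Assignment V) {A B} → A ≈ B → eval α A ≡ eval α B
  eval-cong α ≈-refl        = refl
  eval-cong α (≈-sym p)     = sym (eval-cong α p)
  eval-cong α (≈-trans p q) = trans (eval-cong α p) (eval-cong α q)
  eval-cong α (⋁-cong p q)  = cong₂ _∨_ (eval-cong α p) (eval-cong α q)
  eval-cong α (⋁-assoc {A}) = ∨-assoc (eval α A) _ _
  eval-cong α (⋁-comm {A})  = ∨-comm (eval α A) _
  eval-cong α ⋁-idem        = ∨-idem _
  eval-cong α ⋁-unit        = refl
  eval-cong α (⋀-cong p q)  = cong₂ _∧_ (eval-cong α p) (eval-cong α q)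
  eval-cong α (⋀-assoc {A}) = ∧-assoc (eval α A) _ _
  eval-cong α (⋀-comm {A})  = ∧-comm (eval α A) _
  eval-cong α ⋀-idem        = ∧-idem _
  eval-cong α ⋀-unit        = refl

  eval-dual : ∀ (α : Assignment V) A → eval α (dual A) ≡ not (eval α A)
  eval-dual α (pos X) = refl
  eval-dual α (neg X) = sym (not-involutive (α X))
  eval-dual α ⊥′      = refl
  eval-dual α ⊤′      = refl
  eval-dual α (A ⋁ B) =
    trans (cong₂ _∧_ (eval-dual α A) (eval-dual α B)) (sym (deMorgan₂ (eval α A) _))
  eval-dual α (A ⋀ B) =
    trans (cong₂ _∨_ (eval-dual α A) (eval-dual α B)) (sym (deMorgan₁ (eval α A) _))

  eval-[] : ∀ (α : Assignment V) σ A → eval α (A [ σ ]) ≡ eval (eval α ∘ σ) A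
  eval-[] α σ (pos X) = refl
  eval-[] α σ (neg X) = eval-dual α (σ X)
  eval-[] α σ ⊥′      = refl
  eval-[] α σ ⊤′      = refl
  eval-[] α σ (A ⋁ B) = cong₂ _∨_ (eval-[] α σ A) (eval-[] α σ B)
  eval-[] α σ (A ⋀ B) = cong₂ _∧_ (eval-[] α σ A) (eval-[] α σ B)

-- Falsified premises and conclusions of a single inference.

distinct⇒1<n : ∀ {n} {i j : Fin n} → j ≢ i → 1 ℕ.< n
distinct⇒1<n {suc zero}    {zero} {zero} j≢i = contradiction refl j≢i
distinct⇒1<n {suc (suc n)} _ = s≤s (s≤s z≤n)

module _ {V : Set} {𝓡 : Pred (Rule V) 0ℓ}
         (sound : ∀ R → R ∈ 𝓡 → Sound R)
         (others : ∀ R → R ∈ 𝓡 → FalsifiedSatisfiesOthers R)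
         (Π : PreProof 𝓡) (α : Assignment V) where
  open PreProof Π

  falsified : J → Bool
  falsified u = not (eval α (label u))

  falseIn falseOut : I → J → Bool
  falseIn  w u = falsified u ∧ edgeJI u w
  falseOut w u = falsified u ∧ edgeIJ w u

  -- Soundness and (*) concern the uninstantiated rule; under this assignment its formulas take the
  -- values that their instances at `w` take under `α`.
  assignment : I → Assignment V
  assignment w = eval α ∘ σ w

  eval-premise : ∀ w i → eval α (label (proj₁ (Inverse.to (ins w) i))) ≡
                         eval (assignment w) (lookup (premises (rule w)) i)
  eval-premise w i = trans (eval-cong α (ins-label w i)) (eval-[] α (σ w) (lookup (premises (rule w)) i))

  eval-conclusion : ∀ w j → eval α (label (proj₁ (Inverse.to (outs w) j))) ≡
                            eval (assignment w) (lookup (conclusions (rule w)) j)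
  eval-conclusion w j = trans (eval-cong α (outs-label w j)) (eval-[] α (σ w) (lookup (conclusions (rule w)) j))

  -- Flow is counted over vertices, whereas (*) and soundness speak of list positions; the bijection
  -- `outs w` leads from the vertex back to its position.
  falsified-conclusion : ∀ w u → T (falseOut w u) →
    ∃[ j ] (proj₁ (Inverse.to (outs w) j) ≡ u ×
            assignment w ⊭ lookup (conclusions (rule w)) j)
  falsified-conclusion w u t with Equivalence.to T-∧ t
  ... | fu , e = j , j↦u , trans (sym (eval-conclusion w j))
    (trans (cong (eval α ∘ label) j↦u) (Equivalence.to T-not-≡ fu))
    where
    j = Inverse.from (outs w) (u , e)
    j↦u = cong proj₁ (Inverse.strictlyInverseˡ (outs w) (u , e))

  -- Two falsified conclusions at different positions contradict (*), whose length condition holds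
  -- because the positions differ; equal positions carry the same vertex.
  falseOut-unique : ∀ w u v → T (falseOut w u) → T (falseOut w v) → u ≡ v
  falseOut-unique w u v tu tv
    with falsified-conclusion w u tu | falsified-conclusion w v tv
  ... | i , i↦u , ⊭i | j , j↦v , ⊭j with j ≟ᶠ i
  ... | yes refl = trans (sym i↦u) j↦v
  ... | no j≢i   = contradiction
    (trans (sym ⊭j) (others (rule w) (rule∈𝓡 w) (distinct⇒1<n j≢i) (assignment w) i ⊭i j j≢i))
    λ ()

  -- Contraposed soundness. Searching the finitely many vertices yields an actual falsified premise.
  falseOut⇒falseIn : ∀ w → ∃[ u ] T (falseOut w u) → ∃[ v ] T (falseIn w v)
  falseOut⇒falseIn w (u , t) with any? (T? ∘ falseIn w)
  ... | yes some = some
  ... | no none with falsified-conclusion w u t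
  ... | j , _ , ⊭j = contradiction
    (trans (sym ⊭j) (sound (rule w) (rule∈𝓡 w) (assignment w) premises-true j))
    λ ()
    where
    premises-true : ∀ i → assignment w ⊨ lookup (premises (rule w)) i
    premises-true i with Inverse.to (ins w) i in eq
    ... | v , e = ¬-not λ ⊭i → none (v , Equivalence.from T-∧
      ( Equivalence.from T-not-≡
          (trans (cong (eval α ∘ label ∘ proj₁) (sym eq)) (trans (eval-premise w i) ⊭i))
      , e))

  -- Double counting of the flow through falsified vertices.

  module _ (𝓕 : Flow Π) where
    open Flow 𝓕

    f : I → ℕ → ℚ
    f w n = seq (F w) n

    falseBalance : J → ℕ → ℚ
    falseBalance u n = when (falsified u) (seq (balance Π 𝓕 u) n)

    inflow outflow : ℕ → J → ℚ
    inflow  n u = sum (λ w → when (falseOut w u) (f w n))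
    outflow n u = sum (λ w → when (falseIn  w u) (f w n))

    -- Written additively so that summing over vertices only needs `sum` to distribute over `+`.
    falseBalance-+-outflow : ∀ n u → falseBalance u n + outflow n u ≡ inflow n u
    falseBalance-+-outflow n u with falsified u
    ... | false = +-identityˡ _
    ... | true  = trans
      (cong₂ (λ a b → a - b + out)
        (seq-sumℝ-filter F (λ w → edgeIJ w u) n id)
        (seq-sumℝ-filter F (λ w → edgeJI u w) n id))
      (solve 2 (λ a b → a :- b :+ b := a) refl _ out)
      where out = sum (λ w → when (edgeJI u w) (f w n))

    inflow≤outflow : ∀ n → (∀ w → 0ℚ ≤ f w n) → sum (inflow n) ≤ sum (outflow n)
    inflow≤outflow n f≥0 = begin
      sum (inflow n)
        ≡⟨ ∑-comm (λ u w → when (falseOut w u) (f w n)) ⟩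
      sum (λ w → sum (λ u → when (falseOut w u) (f w n)))
        -- With the sum over inferences outermost, the comparison is local to each `w`.
        ≤⟨ sum-mono-≤ (λ w → sum-when-mono (falseOut w) (falseIn w) (f≥0 w)
             (falseOut-unique w) (falseOut⇒falseIn w)) ⟩
      sum (λ w → sum (λ u → when (falseIn w u) (f w n)))
        ≡⟨ ∑-comm (λ u w → when (falseIn w u) (f w n)) ⟨
      sum (outflow n) ∎
      where open ≤-Reasoning

    -- Adding the total outflow to this sum gives the total inflow, which does not exceed that
    -- outflow.
    falseBalance-sum≯0 : ∀ n → (∀ w → 0ℚ ≤ f w n) → ¬ (0ℚ < sum (λ u → falseBalance u n))
    falseBalance-sum≯0 n f≥0 0<Σ = <-irrefl refl (begin-strict
      sum (inflow n)
        ≤⟨ inflow≤outflow n f≥0 ⟩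
      sum (outflow n)
        ≡⟨ +-identityˡ _ ⟨
      0ℚ + sum (outflow n)
        <⟨ +-monoˡ-< _ 0<Σ ⟩
      sum (λ u → falseBalance u n) + sum (outflow n)
        ≡⟨ ∑-distrib-+ (λ u → falseBalance u n) (outflow n) ⟨
      sum (λ u → falseBalance u n + outflow n u)
        ≡⟨ sum-cong-≗ (falseBalance-+-outflow n) ⟩
      sum (inflow n) ∎)
      where open ≤-Reasoning

    -- A positive real may have negative early terms; as there are finitely many inferences, one
    -- threshold serves them all.
    flow-eventually-nonNeg : Eventually (λ n → ∀ w → 0ℚ ≤ f w n)
    flow-eventually-nonNeg = eventually-∀ λ w → let (ε , 0<ε , N , h) = positive w in
      N , λ n n≥N → <⇒≤ (<-trans 0<ε (subst (_< f w n) (+-identityˡ ε) (h n n≥N)))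

    sink-true : (∀ u → IsSource Π 𝓕 u → α ⊨ label u) →
                                ∀ u → IsSink Π 𝓕 u → α ⊨ label u
    sink-true sources-true s (ε , 0<ε , N , h) = ¬-not λ ⊭s →
      let δ , 0<δ , Σ>δ     = boundedBelow₀-sum nonNeg s (positive-at-sink ⊭s)
          -- Past `M` both eventual facts hold, so the rational terms at the single index `M`
          -- already clash.
          M , contradictory = eventually-zip
            (λ n Σₙ>δ f≥0 → falseBalance-sum≯0 n f≥0 (<-trans 0<δ Σₙ>δ))
            Σ>δ flow-eventually-nonNeg
      in contradictory M ℕ.≤-refl
      where
      nonNeg : ∀ u → AlmostNonNeg (falseBalance u)
      nonNeg u with eval α (label u) in eq
      ... | true  = almostNonNeg-0
      ... | false = ≮0⇒almostNonNeg (balance Π 𝓕 u) λ source →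
        contradiction (trans (sym eq) (sources-true u source)) λ ()

      positive-at-sink : α ⊭ label s → BoundedBelow₀ (falseBalance s)
      positive-at-sink ⊭s rewrite ⊭s =
        ε , 0<ε , N , λ n n≥N → subst (_< _) (+-identityˡ ε) (h n n≥N)

theorem2 : {V : Set} (𝓡 : Pred (Rule V) 0ℓ) →
    (∀ R → R ∈ 𝓡 → Sound R) →
    (∀ R → R ∈ 𝓡 → FalsifiedSatisfiesOthers R) →
    (𝓗 : Pred (Formula V) 0ℓ) (A : Formula V) →
    CircularProof 𝓡 𝓗 A →
    (α : Assignment V) → (∀ B → B ∈ 𝓗 → α ⊨ B) → α ⊨ A
theorem2 𝓡 sound others 𝓗 A proof α hyps =
  let sources , u , sink , u≈A = witnesses in
  trans (sym (eval-cong α u≈A))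
    (sink-true sound others preProof α flow
      (λ v source → let B , B∈𝓗 , v≈B = sources v source in
        trans (eval-cong α v≈B) (hyps B B∈𝓗))
      u sink)
  where open CircularProof proof
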